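{- Let GCGMPs, configurations and plays be as defined in the context. There is an effective construction which assigns to every two-counter machine $A$ a finite GCGMP $\mathfrak{M}^A$ with exactly two players $1,2$, integer payoffs, and a set of atomic propositions containing a distinguished proposition $\mathsf{halt}$, together with an initial configuration, such that: $A$ halts on the empty input if and only if $\mathfrak{M}^A$ contains a play $\pi$ from that initial configuration whose sequence of configurations is $\pi^c=(s^0,(v_1^0,v_2^0))(s^1,(v_1^1,v_2^1))\dots$ and for which there exists $j\in\mathbb{N}$ with $\mathsf{halt}\in \mathsf{L}(s^j)$.
   Context: A two-counter machine is a finite-state (nondeterministic) machine with two counters ranging over the non-negative integers; each transition depends on the current control state and on whether each counter is zero or non-zero, and changes the control state and increments or decrements each counter by one (or leaves it unchanged), a decrement being allowed only on a non-zero counter; it halts if it reaches an accepting state. It is Turing-complete. A guarded concurrent game model with payoffs (GCGMP) consists of: a finite set of players $\mathsf{Ag}=\{1,\dots,k\}$; a non-empty set of states $\mathsf{St}$; for each player $a$ a non-empty action set $\mathsf{Act}_a$; a transition function $\mathsf{out}:\mathsf{St}\times\prod_{a}\mathsf{Act}_a\to\mathsf{St}$; a set of atomic propositions $\Pi$ with labelling $\mathsf{L}:\mathsf{St}\to 2^{\Pi}$; a payoff function $\mathsf{payoff}_a(s,\vec\alpha)\in\mathbb{D}\subseteq\mathbb{R}$ for each player $a$, state $s$ and action profile $\vec\alpha$; for each player $a$ a guard function $g_a$ assigning to each state $s$ and action $\alpha\in\mathsf{Act}_a$ a Boolean combination of linear (in)equalities between sums of constants and the variable $v_a$ (the accumulated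 payoff of $a$), such that at every state and every value of $v_a$ at least one action of $a$ is enabled; and a discount factor $d_a\in[0,1]$ for each player. A configuration is a pair $(s,\vec u)$ with $s\in\mathsf{St}$ and $\vec u\in\mathbb{D}^{k}$ the vector of accumulated payoffs. The configuration transition at step $l$ maps $((s,\vec u),\vec\alpha)$ to $(s',\vec u')$ iff $\mathsf{out}(s,\vec\alpha)=s'$, for each $a$ the value $u_a$ of $v_a$ satisfies $g_a(s,\alpha_a)$, and $u'_a=u_a+d_a^l\,\mathsf{payoff}_a(s,\vec\alpha)$ for each $a$. A play is an infinite sequence $c_0\vec\alpha_0,c_1\vec\alpha_1,\dots$ of configurations and action profiles with each $c_{n}$ obtained from $c_{n-1}$ and $\vec\alpha_{n-1}$ by the configuration transition; $\pi^c$ denotes its sequence of configurations. -}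

module Defs where

open import Data.Nat using (ℕ; zero; suc)
open import Data.Fin using (Fin)
open import Data.Bool using (Bool; true; false)
open import Data.Maybe using (Maybe; just; nothing)
open import Data.Product using (Σ; proj₁; _×_; _,_; ∃; ∃-syntax)
open import Data.Sum using (_⊎_)
open import Data.Unit using (⊤)
open import Data.Empty using (⊥)
open import Data.List using (List)
open import Data.List.Membership.Propositional using (_∈_)
open import Data.Integer using (ℤ)
open import Data.Rational using (ℚ; 0ℚ; 1ℚ; _+_; _*_; _≤_; _<_; _/_)
open import Relation.Nullary using (¬_)
open import Relation.Binary.PropositionalEquality using (_≡_)
open import Relation.Binary.Construct.Closure.ReflexiveTransitive using (Star)

data CounterOp : Set where
  inc dec nop : CounterOp

applyOp : CounterOp → ℕ → Maybe ℕ
applyOp inc n       = just (suc n)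
applyOp dec zero    = nothing
applyOp dec (suc n) = just n
applyOp nop n       = just n

isZero : ℕ → Bool
isZero zero    = true
isZero (suc _) = false

-- A transition: source state, zero-tests of the two counters
-- (true = "is zero", false = "is non-zero"), target state, and the
-- operations on the two counters.
record TCMTransition (nQ : ℕ) : Set where
  field
    from  : Fin nQ
    zero₁ : Bool
    zero₂ : Bool
    to    : Fin nQ
    op₁   : CounterOp
    op₂   : CounterOp

record TwoCounterMachine : Set where
  field
    nQ          : ℕ
    initial     : Fin nQ
    accepting   : Fin nQ → Bool
    transitions : List (TCMTransition nQ)

TCMConfig : TwoCounterMachine → Set
TCMConfig A = Fin (TwoCounterMachine.nQ A) × ℕ × ℕ

data TCMStep (A : TwoCounterMachine) : TCMConfig A → TCMConfig A → Set where
  step : ∀ (t : TCMTransition (TwoCounterMachine.nQ A)) {c₁ c₂ c₁' c₂'} →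
         t ∈ TwoCounterMachine.transitions A →
         isZero c₁ ≡ TCMTransition.zero₁ t →
         isZero c₂ ≡ TCMTransition.zero₂ t →
         applyOp (TCMTransition.op₁ t) c₁ ≡ just c₁' →
         applyOp (TCMTransition.op₂ t) c₂ ≡ just c₂' →
         TCMStep A (TCMTransition.from t , c₁ , c₂) (TCMTransition.to t , c₁' , c₂')

Halts : TwoCounterMachine → Set
Halts A = ∃[ q ] ∃[ c₁ ] ∃[ c₂ ]
  (Star (TCMStep A) (TwoCounterMachine.initial A , 0 , 0) (q , c₁ , c₂)
   × TwoCounterMachine.accepting A q ≡ true)

-- Guards: Boolean combinations of linear (in)equalities between sums of
-- constants and the variable v (the player's accumulated payoff).

data GTerm : Set where
  const : ℚ → GTerm
  var   : GTerm
  _⊕_   : GTerm → GTerm → GTerm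

data Guard : Set where
  _≤ᵍ_ _<ᵍ_ _=ᵍ_ : GTerm → GTerm → Guard
  ⊤ᵍ ⊥ᵍ          : Guard
  ¬ᵍ_            : Guard → Guard
  _∧ᵍ_ _∨ᵍ_      : Guard → Guard → Guard

evalT : GTerm → ℚ → ℚ
evalT (const q) v = q
evalT var       v = v
evalT (t ⊕ u)   v = evalT t v + evalT u v

⟦_⟧ᵍ : Guard → ℚ → Set
⟦ t ≤ᵍ u ⟧ᵍ v = evalT t v ≤ evalT u v
⟦ t <ᵍ u ⟧ᵍ v = evalT t v < evalT u v
⟦ t =ᵍ u ⟧ᵍ v = evalT t v ≡ evalT u v
⟦ ⊤ᵍ ⟧ᵍ v     = ⊤
⟦ ⊥ᵍ ⟧ᵍ v     = ⊥
⟦ ¬ᵍ g ⟧ᵍ v   = ¬ ⟦ g ⟧ᵍ v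
⟦ g ∧ᵍ h ⟧ᵍ v = ⟦ g ⟧ᵍ v × ⟦ h ⟧ᵍ v
⟦ g ∨ᵍ h ⟧ᵍ v = ⟦ g ⟧ᵍ v ⊎ ⟦ h ⟧ᵍ v

ℤ→ℚ : ℤ → ℚ
ℤ→ℚ z = z / 1

_^ℚ_ : ℚ → ℕ → ℚ
q ^ℚ zero  = 1ℚ
q ^ℚ suc n = q * (q ^ℚ n)

record FinGCGMP (k : ℕ) : Set where
  field
    nSt      : ℕ
    nAct     : Fin k → ℕ
    nProp    : ℕ
  Profile : Set
  Profile = (a : Fin k) → Fin (nAct a)
  field
    out      : Fin nSt → Profile → Fin nSt
    L        : Fin nSt → Fin nProp → Bool
    payoff   : Fin k → Fin nSt → Profile → ℤ
    guard    : (a : Fin k) → Fin nSt → Fin (nAct a) → Guard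
    enabled  : ∀ (a : Fin k) (s : Fin nSt) (v : ℚ) →
               ∃[ α ] ⟦ guard a s α ⟧ᵍ v
    discount : Fin k → ℚ
    discount-lo : ∀ a → 0ℚ ≤ discount a
    discount-hi : ∀ a → discount a ≤ 1ℚ

module _ {k : ℕ} (M : FinGCGMP k) where
  open FinGCGMP M

  Config : Set
  Config = Fin nSt × (Fin k → ℚ)

  ConfStep : ℕ → Config → Profile → Config → Set
  ConfStep l (s , u) α (s' , u') =
    (out s α ≡ s')
    × (∀ a → ⟦ guard a s (α a) ⟧ᵍ (u a))
    × (∀ a → u' a ≡ u a + (discount a ^ℚ l) * ℤ→ℚ (payoff a s α))

  record Play (c₀ : Config) : Set where
    field
      conf    : ℕ → Config
      profile : ℕ → Profile
      start   : conf 0 ≡ c₀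
      steps   : ∀ n → ConfStep n (conf n) (profile n) (conf (suc n))

record Reduction : Set where
  field
    model    : FinGCGMP 2
    halt     : Fin (FinGCGMP.nProp model)
    initSt   : Fin (FinGCGMP.nSt model)
    initPay  : Fin 2 → ℤ
  initConf : Config model
  initConf = initSt , (λ a → ℤ→ℚ (initPay a))

ReachesHalt : Reduction → Set
ReachesHalt R =
  Σ (Play model initConf) λ π →
    ∃[ j ] FinGCGMP.L model (proj₁ (Play.conf π j)) halt ≡ true
  where open Reduction R

-- Each player keeps one counter of the machine as its accumulated payoff: with discount
-- factor 1 a transition adds −1, 0 or +1 to it, and a guard on the payoff performs the zero
-- test (and forbids decrementing zero).  The game's states are the machine's control states
-- plus a sink where halt never holds; the play follows a machine transition when both players
-- name it and it leaves the current state, and falls into the sink otherwise.  So the play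
-- prefixes before the sink are exactly the runs of the machine, and halt marks acceptance.
module Submission where

open import Defs
open import Data.Bool using (Bool; true; false)
open import Data.Empty using (⊥-elim)
open import Data.Fin using (Fin; zero; suc; _≟_)
open import Data.Fin.Properties using (0≢1+n; suc-injective)
open import Data.Integer as ℤ using (ℤ; +_; -[1+_])
import Data.Integer.GCD as ℤ
import Data.Integer.Properties as ℤ
open import Data.List using (length; lookup)
open import Data.List.Membership.Propositional using (_∈_)
open import Data.List.Membership.Propositional.Properties using (∈-lookup)
open import Data.List.Relation.Unary.Any using (index)
open import Data.List.Relation.Unary.Any.Properties using (lookup-index)
open import Data.Maybe using (just)
open import Data.Nat using (ℕ; zero; suc)
import Data.Nat.GCD as ℕ
import Data.Nat.Properties as ℕ
open import Data.Product using (Σ; ∃; ∃-syntax; _×_; _,_; proj₁; proj₂)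
open import Data.Rational using (ℚ; 0ℚ; 1ℚ; _+_; _*_; ↥_; toℚᵘ)
open import Data.Rational.Properties
  using (↥-/; toℚᵘ-injective; toℚᵘ-homo-+; toℚᵘ-fromℚᵘ; *-identityˡ; *-zeroʳ; +-identityʳ;
         ≤-refl; nonNegative⁻¹)
open import Data.Rational.Unnormalised as ℚᵘ using (mkℚᵘ; *≡*)
import Data.Rational.Unnormalised.Properties as ℚᵘ
open import Data.Sum using (_⊎_; inj₁; inj₂)
open import Data.Unit using (tt)
open import Function using (_∘_)
open import Relation.Binary.Construct.Closure.ReflexiveTransitive using (Star; ε; _◅_; _◅◅_)
open import Relation.Binary.PropositionalEquality
open import Relation.Nullary using (yes; no; contradiction)

↥-ℤ→ℚ : ∀ i → ↥ ℤ→ℚ i ≡ i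
↥-ℤ→ℚ i = begin
  ↥ ℤ→ℚ i                   ≡⟨ sym (ℤ.*-identityʳ _) ⟩
  ↥ ℤ→ℚ i ℤ.* + 1           ≡⟨ cong (λ g → ↥ ℤ→ℚ i ℤ.* + g) (sym (ℕ.gcd-zeroʳ ℤ.∣ i ∣)) ⟩
  ↥ ℤ→ℚ i ℤ.* ℤ.gcd i (+ 1) ≡⟨ ↥-/ i 1 ⟩
  i                         ∎
  where open ≡-Reasoning

ℤ→ℚ-injective : ∀ {i j} → ℤ→ℚ i ≡ ℤ→ℚ j → i ≡ j
ℤ→ℚ-injective {i} {j} eq = trans (sym (↥-ℤ→ℚ i)) (trans (cong ↥_ eq) (↥-ℤ→ℚ j))

ℤ→ℚ-homo-+ : ∀ i j → ℤ→ℚ (i ℤ.+ j) ≡ ℤ→ℚ i + ℤ→ℚ j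
ℤ→ℚ-homo-+ i j = toℚᵘ-injective (begin
  toℚᵘ (ℤ→ℚ (i ℤ.+ j))            ≈⟨ toℚᵘ-fromℚᵘ (mkℚᵘ (i ℤ.+ j) 0) ⟩
  mkℚᵘ (i ℤ.+ j) 0                ≈⟨ *≡* (cong (ℤ._* + 1) (cong₂ ℤ._+_ (sym (ℤ.*-identityʳ i))
                                                                      (sym (ℤ.*-identityʳ j)))) ⟩
  mkℚᵘ i 0 ℚᵘ.+ mkℚᵘ j 0          ≈⟨ ℚᵘ.+-cong (toℚᵘ-fromℚᵘ (mkℚᵘ i 0)) (toℚᵘ-fromℚᵘ (mkℚᵘ j 0)) ⟨
  toℚᵘ (ℤ→ℚ i) ℚᵘ.+ toℚᵘ (ℤ→ℚ j) ≈⟨ toℚᵘ-homo-+ (ℤ→ℚ i) (ℤ→ℚ j) ⟨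
  toℚᵘ (ℤ→ℚ i + ℤ→ℚ j)           ∎)
  where open ℚᵘ.≃-Reasoning

1^ℚ≡1 : ∀ l → 1ℚ ^ℚ l ≡ 1ℚ
1^ℚ≡1 zero    = refl
1^ℚ≡1 (suc l) = trans (cong (1ℚ *_) (1^ℚ≡1 l)) (*-identityˡ 1ℚ)

undiscounted-+ : ∀ l i j → ℤ→ℚ (i ℤ.+ j) ≡ ℤ→ℚ i + (1ℚ ^ℚ l) * ℤ→ℚ j
undiscounted-+ l i j = begin
  ℤ→ℚ (i ℤ.+ j)                  ≡⟨ ℤ→ℚ-homo-+ i j ⟩
  ℤ→ℚ i + ℤ→ℚ j                  ≡⟨ cong (λ v → ℤ→ℚ i + v) (sym (*-identityˡ (ℤ→ℚ j))) ⟩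
  ℤ→ℚ i + 1ℚ * ℤ→ℚ j             ≡⟨ cong (λ d → ℤ→ℚ i + d * ℤ→ℚ j) (sym (1^ℚ≡1 l)) ⟩
  ℤ→ℚ i + (1ℚ ^ℚ l) * ℤ→ℚ j      ∎
  where open ≡-Reasoning

ℕ→ℚ : ℕ → ℚ
ℕ→ℚ n = ℤ→ℚ (+ n)

ℕ→ℚ-injective : ∀ {m n} → ℕ→ℚ m ≡ ℕ→ℚ n → m ≡ n
ℕ→ℚ-injective = ℤ.+-injective ∘ ℤ→ℚ-injective

Δ : CounterOp → ℤ
Δ inc = + 1
Δ dec = -[1+ 0 ]
Δ nop = + 0

applyOp-Δ : ∀ o {c c'} → applyOp o c ≡ just c' → + c' ≡ + c ℤ.+ Δ o
applyOp-Δ inc {c}     refl = cong +_ (ℕ.+-comm 1 c)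
applyOp-Δ dec {suc c} refl = refl
applyOp-Δ nop {c}     refl = sym (ℤ.+-identityʳ (+ c))

applyOp-suc : ∀ o c → ∃ λ c' → applyOp o (suc c) ≡ just c'
applyOp-suc inc c = suc (suc c) , refl
applyOp-suc dec c = c , refl
applyOp-suc nop c = suc c , refl

CounterStep : Bool → CounterOp → ℕ → ℕ → Set
CounterStep z o c c' = isZero c ≡ z × applyOp o c ≡ just c'

CounterStep-payoff : ∀ {z o c c'} → CounterStep z o c c' →
                     ∀ l → ℕ→ℚ c' ≡ ℕ→ℚ c + (1ℚ ^ℚ l) * ℤ→ℚ (Δ o)
CounterStep-payoff {o = o} {c} (_ , applied) l =
  trans (cong ℤ→ℚ (applyOp-Δ o applied)) (undiscounted-+ l (+ c) (Δ o))

zeroTest : Bool → CounterOp → Guard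
zeroTest true  dec = ⊥ᵍ
zeroTest true  _   = var =ᵍ const 0ℚ
zeroTest false _   = ¬ᵍ (var =ᵍ const 0ℚ)

zeroTest-sound : ∀ {z o c c'} → CounterStep z o c c' → ⟦ zeroTest z o ⟧ᵍ (ℕ→ℚ c)
zeroTest-sound {true}  {dec} {zero}  (_ , ())
zeroTest-sound {true}  {inc} {zero}  _ = refl
zeroTest-sound {true}  {nop} {zero}  _ = refl
zeroTest-sound {true}  {c = suc _} (() , _)
zeroTest-sound {false} {c = zero}  (() , _)
zeroTest-sound {false} {c = suc c} _ = λ eq → contradiction (ℕ→ℚ-injective {suc c} {0} eq) λ ()

zeroTest-complete : ∀ {z o} c → ⟦ zeroTest z o ⟧ᵍ (ℕ→ℚ c) → ∃ (CounterStep z o c)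
zeroTest-complete {true}  {dec} c ()
zeroTest-complete {true}  {inc} c eq with ℕ→ℚ-injective {c} {0} eq
... | refl = 1 , refl , refl
zeroTest-complete {true}  {nop} c eq with ℕ→ℚ-injective {c} {0} eq
... | refl = 0 , refl , refl
zeroTest-complete {false}       zero    ≢0 = ⊥-elim (≢0 refl)
zeroTest-complete {false} {o}   (suc c) _  = proj₁ (applyOp-suc o c) , refl , proj₂ (applyOp-suc o c)

zeroTest-step : ∀ {z o c v'} l → ⟦ zeroTest z o ⟧ᵍ (ℕ→ℚ c) →
                v' ≡ ℕ→ℚ c + (1ℚ ^ℚ l) * ℤ→ℚ (Δ o) →
                ∃ λ c' → CounterStep z o c c' × v' ≡ ℕ→ℚ c'
zeroTest-step {c = c} l holds v'≡ with zeroTest-complete c holds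
... | c' , counterStep = c' , counterStep , trans v'≡ (sym (CounterStep-payoff counterStep l))

module _ {k : ℕ} (M : FinGCGMP k) where
  open FinGCGMP M using (Profile)

  UniformStep : Config M → Config M → Set
  UniformStep c c' = Σ Profile λ α → ∀ l → ConfStep M l c α c'

  Play-invariant : (P : Config M → Set) →
                   (∀ l c α c' → ConfStep M l c α c' → P c → P c') →
                   ∀ {c₀} → P c₀ → (π : Play M c₀) → ∀ n → P (Play.conf π n)
  Play-invariant P preserved init π zero    = subst P (sym (Play.start π)) init
  Play-invariant P preserved init π (suc n) =
    preserved n (Play.conf π n) (Play.profile π n) (Play.conf π (suc n)) (Play.steps π n)
              (Play-invariant P preserved init π n)

  module _ (continue : ∀ c → ∃ (UniformStep c)) where

    private
      along : ∀ {c₀ c} → Star UniformStep c₀ c → ℕ → Config M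
      along {c₀} _       zero    = c₀
      along      p@ε     (suc n) = proj₁ (continue (along p n))
      along      (_ ◅ p) (suc n) = along p n

      choices : ∀ {c₀ c} → Star UniformStep c₀ c → ℕ → Profile
      choices p@ε     n       = proj₁ (proj₂ (continue (along p n)))
      choices (s ◅ p) zero    = proj₁ s
      choices (s ◅ p) (suc n) = choices p n

      along-steps : ∀ {c₀ c} (p : Star UniformStep c₀ c) n l →
                    ConfStep M l (along p n) (choices p n) (along p (suc n))
      along-steps p@ε     n       = proj₂ (proj₂ (continue (along p n)))
      along-steps (s ◅ p) zero    = proj₂ s
      along-steps (s ◅ p) (suc n) = along-steps p n

      along-reaches : ∀ {c₀ c} (p : Star UniformStep c₀ c) → ∃[ j ] along p j ≡ c
      along-reaches ε       = 0 , refl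
      along-reaches (s ◅ p) with along-reaches p
      ... | j , reached = suc j , reached

    play-through : ∀ {c₀ c} → Star UniformStep c₀ c →
                   Σ (Play M c₀) λ π → ∃[ j ] Play.conf π j ≡ c
    play-through p =
        record { conf = along p ; profile = choices p ; start = refl ; steps = λ n → along-steps p n n }
      , along-reaches p

module Simulation (A : TwoCounterMachine) where
  open TwoCounterMachine A
  open TCMTransition

  #transitions : ℕ
  #transitions = length transitions

  transition : Fin #transitions → TCMTransition nQ
  transition = lookup transitions

  counter : Fin 2 → TCMConfig A → ℕ
  counter zero    (_ , c , _) = c
  counter (suc _) (_ , _ , c) = c

  test : Fin 2 → TCMTransition nQ → Bool
  test zero    = zero₁
  test (suc _) = zero₂

  op : Fin 2 → TCMTransition nQ → CounterOp
  op zero    = op₁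
  op (suc _) = op₂

  Fires : TCMTransition nQ → TCMConfig A → TCMConfig A → Set
  Fires t x y = proj₁ x ≡ from t × proj₁ y ≡ to t ×
                (∀ a → CounterStep (test a t) (op a t) (counter a x) (counter a y))

  step⇒fires : ∀ {x y} → TCMStep A x y → ∃[ i ] Fires (transition i) x y
  step⇒fires (step t t∈ z₁ z₂ o₁ o₂) with index t∈ | lookup-index t∈
  ... | i | refl = i , refl , refl , λ { zero → z₁ , o₁ ; (suc zero) → z₂ , o₂ }

  fires⇒step : ∀ {t x y} → t ∈ transitions → Fires t x y → TCMStep A x y
  fires⇒step {t} {_ , _ , _} {_ , _ , _} t∈ (refl , refl , counters) =
    step t t∈ (proj₁ (counters zero)) (proj₁ (counters (suc zero)))
              (proj₂ (counters zero)) (proj₂ (counters (suc zero)))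

  State : Set
  State = Fin (suc nQ)

  Action : Set
  Action = Fin (suc #transitions)

  -- State zero is the sink; action zero is idling, action suc i proposes transition i.
  move : Action → Action → State → State
  move (suc i) (suc j) (suc q) with i ≟ j | from (transition i) ≟ q
  ... | yes _ | yes _ = suc (to (transition i))
  ... | _     | _     = zero
  move _       _       _       = zero

  move-sink : ∀ a b → move a b zero ≡ zero
  move-sink zero    _       = refl
  move-sink (suc i) zero    = refl
  move-sink (suc i) (suc j) = refl

  move-fire : ∀ i → move (suc i) (suc i) (suc (from (transition i))) ≡ suc (to (transition i))
  move-fire i with i ≟ i | from (transition i) ≟ from (transition i)
  ... | yes _  | yes _  = refl
  ... | no i≢i | _      = contradiction refl i≢i
  ... | yes _  | no q≢q = contradiction refl q≢q

  move-inv : ∀ {a b q q'} → move a b (suc q) ≡ suc q' →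
             ∃[ i ] a ≡ suc i × b ≡ suc i × from (transition i) ≡ q × to (transition i) ≡ q'
  move-inv {suc i} {suc j} {q} eq with i ≟ j | from (transition i) ≟ q
  ... | yes refl | yes from≡ = i , refl , refl , from≡ , suc-injective eq
  ... | yes _    | no _      = ⊥-elim (0≢1+n eq)
  ... | no _     | _         = ⊥-elim (0≢1+n eq)

  guard : Fin 2 → Action → Guard
  guard a zero    = ⊤ᵍ
  guard a (suc i) = zeroTest (test a (transition i)) (op a (transition i))

  effect : Fin 2 → Action → ℤ
  effect a zero    = + 0
  effect a (suc i) = Δ (op a (transition i))

  label : State → Bool
  label zero    = false
  label (suc q) = accepting q

  model : FinGCGMP 2
  model = record
    { nSt         = suc nQ
    ; nAct        = λ _ → suc #transitions
    ; nProp       = 1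
    ; out         = λ s α → move (α zero) (α (suc zero)) s
    ; L           = λ s _ → label s
    ; payoff      = λ a _ α → effect a (α a)
    ; guard       = λ a _ → guard a
    ; enabled     = λ _ _ _ → zero , tt
    ; discount    = λ _ → 1ℚ
    ; discount-lo = λ _ → nonNegative⁻¹ 1ℚ
    ; discount-hi = λ _ → ≤-refl
    }

  reduction : Reduction
  reduction = record { model = model ; halt = zero ; initSt = suc initial ; initPay = λ _ → + 0 }

  Encodes : TCMConfig A → Config model → Set
  Encodes x (s , u) = s ≡ suc (proj₁ x) × ∀ a → u a ≡ ℕ→ℚ (counter a x)

  embed : TCMConfig A → Config model
  embed x = suc (proj₁ x) , λ a → ℕ→ℚ (counter a x)

  embed-encodes : ∀ x → Encodes x (embed x)
  embed-encodes x = refl , λ a → refl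

  initial-encodes : Encodes (initial , 0 , 0) (Reduction.initConf reduction)
  initial-encodes = refl , λ { zero → refl ; (suc zero) → refl }

  idle-step : ∀ c → ∃ (UniformStep model c)
  idle-step (s , u) = (zero , u) , (λ _ → zero) , λ l → refl , (λ _ → tt) , λ a →
    sym (trans (cong (λ v → u a + v) (*-zeroʳ (1ℚ ^ℚ l))) (+-identityʳ (u a)))

  fires⇒UniformStep : ∀ i {x y c} → Encodes x c → Fires (transition i) x y →
                      UniformStep model c (embed y)
  fires⇒UniformStep i {_ , _ , _} {_ , _ , _} {_ , u} (refl , u≡) (refl , refl , counters) =
    (λ _ → suc i) , λ l →
      move-fire i ,
      (λ a → subst ⟦ guard a (suc i) ⟧ᵍ (sym (u≡ a)) (zeroTest-sound (counters a))) ,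
      (λ a → trans (CounterStep-payoff (counters a) l) (cong (λ v → v + _) (sym (u≡ a))))

  run⇒path : ∀ {x y c} → Star (TCMStep A) x y → Encodes x c →
             ∃ λ c' → Encodes y c' × Star (UniformStep model) c c'
  run⇒path ε       enc = _ , enc , ε
  run⇒path (s ◅ r) enc with step⇒fires s | run⇒path r (embed-encodes _)
  ... | i , fires | c' , enc' , path = c' , enc' , fires⇒UniformStep i enc fires ◅ path

  step-back : ∀ {l c α c' x} → ConfStep model l c α c' → Encodes x c →
              proj₁ c' ≡ zero ⊎ ∃ λ y → Encodes y c' × TCMStep A x y
  step-back {c' = zero , _} _ _ = inj₁ refl
  step-back {l} {s , u} {α} {suc q' , u'} {q , c₁ , c₂} (out≡ , guards , pays) (refl , u≡)
    with move-inv {α zero} {α (suc zero)} {q} {q'} out≡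
  ... | i , α₀≡ , α₁≡ , refl , refl = inj₂ (y , (refl , encodes-y) , fires⇒step (∈-lookup i) fires)
    where
    t : TCMTransition nQ
    t = transition i

    x : TCMConfig A
    x = from t , c₁ , c₂

    chosen : ∀ a → α a ≡ suc i
    chosen zero       = α₀≡
    chosen (suc zero) = α₁≡

    next : ∀ a → ∃ λ c' → CounterStep (test a t) (op a t) (counter a x) c' × u' a ≡ ℕ→ℚ c'
    next a = zeroTest-step l
      (subst ⟦ guard a (suc i) ⟧ᵍ (u≡ a) (subst (λ β → ⟦ guard a β ⟧ᵍ (u a)) (chosen a) (guards a)))
      (trans (pays a) (cong₂ (λ v β → v + (1ℚ ^ℚ l) * ℤ→ℚ (effect a β)) (u≡ a) (chosen a)))

    y : TCMConfig A
    y = q' , proj₁ (next zero) , proj₁ (next (suc zero))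

    y-counter : ∀ a → counter a y ≡ proj₁ (next a)
    y-counter zero       = refl
    y-counter (suc zero) = refl

    encodes-y : ∀ a → u' a ≡ ℕ→ℚ (counter a y)
    encodes-y a = trans (proj₂ (proj₂ (next a))) (cong ℕ→ℚ (sym (y-counter a)))

    fires : Fires t x y
    fires = refl , refl , λ a → subst (CounterStep _ _ _) (sym (y-counter a)) (proj₁ (proj₂ (next a)))

  Reachable : Config model → Set
  Reachable c = proj₁ c ≡ zero ⊎ ∃ λ x → Encodes x c × Star (TCMStep A) (initial , 0 , 0) x

  reachable-step : ∀ l c α c' → ConfStep model l c α c' → Reachable c → Reachable c'
  reachable-step _ _ α _ (out≡ , _) (inj₁ refl) =
    inj₁ (trans (sym out≡) (move-sink (α zero) (α (suc zero))))
  reachable-step l c α c' conf-step (inj₂ (x , enc , run))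
    with step-back {l} {c} {α} {c'} conf-step enc
  ... | inj₁ sunk           = inj₁ sunk
  ... | inj₂ (y , enc' , s) = inj₂ (y , enc' , run ◅◅ (s ◅ ε))

  halts⇒halting-play : Halts A → ReachesHalt reduction
  halts⇒halting-play (q , c₁ , c₂ , run , accepted) with run⇒path run initial-encodes
  ... | c , (atQ , _) , path with play-through model idle-step path
  ... | π , j , reached = π , j , trans (cong (label ∘ proj₁) reached) (trans (cong label atQ) accepted)

  halting-play⇒halts : ReachesHalt reduction → Halts A
  halting-play⇒halts (π , j , accepts)
    with Play-invariant model Reachable reachable-step (inj₂ (_ , initial-encodes , ε)) π j
  ... | inj₁ sunk = contradiction (trans (sym (cong label sunk)) accepts) λ ()
  ... | inj₂ ((q , c₁ , c₂) , (atQ , _) , run) = q , c₁ , c₂ , run , trans (sym (cong label atQ)) accepts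

lemma1 : Σ (TwoCounterMachine → Reduction) λ f →
           ∀ (A : TwoCounterMachine) →
             (Halts A → ReachesHalt (f A)) × (ReachesHalt (f A) → Halts A)
lemma1 = Simulation.reduction , λ A → Simulation.halts⇒halting-play A , Simulation.halting-play⇒halts A
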